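{- Let $(P,\leq)$ be a partially ordered set, $S(P):=\{(p,q)\in P^2: p\leq q,\ p\neq q\}$ its strict order, and $O(P)$ the lattice of suborders of $P$, i.e. the set of transitively closed subsets of $S(P)$ ordered by inclusion. Then $O(P)$ is order-scattered if and only if $S(P)$ is finite.
   Context: A poset is order-scattered if it contains no subset order-isomorphic to the chain $\mathbb{Q}$ of rationals. A subset $R\subseteq S(P)$ is transitively closed if $(a,b),(b,c)\in R$ imply $(a,c)\in R$. -}

module Defs where

open import Data.Fin.Base using (Fin)
open import Data.Product.Base using (Σ; ∃-syntax; _×_; _,_; proj₁)
open import Data.Product.Relation.Binary.Pointwise.NonDependent using (×-setoid)
open import Data.Rational.Base using (ℚ) renaming (_≤_ to _≤ℚ_)
open import Function.Base using (id)
open import Function.Bundles using (Bijection)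
open import Level using (Level; _⊔_) renaming (suc to lsuc)
open import Relation.Binary.Bundles using (Setoid; Poset)
open import Relation.Binary.Core using (Rel; _⇒_; _⇔_)
open import Relation.Binary.Definitions using (Transitive; _Respects_; _Respects₂_)
import Relation.Binary.Construct.NonStrictToStrict as ToStrict
import Relation.Binary.Construct.On as On
open import Relation.Binary.Morphism.Structures using (IsOrderIsomorphism)
open import Relation.Binary.PropositionalEquality using (_≡_; setoid)
open import Relation.Nullary.Negation.Core using (¬_)
open import Relation.Unary using (Pred)

Finite : ∀ {a ℓ} → Setoid a ℓ → Set (a ⊔ ℓ)
Finite S = ∃[ n ] Bijection (setoid (Fin n)) S

-- Equality of elements is the poset's own _≈_ throughout, so a subset is a
-- predicate that respects _≈_.

Subposet : ∀ {a ℓ₁ ℓ₂ x} (A : Poset a ℓ₁ ℓ₂) → Pred (Poset.Carrier A) x →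
           Poset (a ⊔ x) ℓ₁ ℓ₂
Subposet A X = On.poset {B = Σ (Poset.Carrier A) X} A proj₁

IsoToℚ : ∀ {a ℓ₁ ℓ₂} → Poset a ℓ₁ ℓ₂ → Set (a ⊔ ℓ₁ ⊔ ℓ₂)
IsoToℚ B = ∃[ f ] IsOrderIsomorphism _≡_ _≈_ _≤ℚ_ _≤_ f
  where open Poset B

-- It is enough to let X range over subsets at the level of _≈_: a subset
-- isomorphic to ℚ via f is, up to _≈_, the image { y ∣ ∃ q. f q ≈ y }.

OrderScattered : ∀ {a ℓ₁ ℓ₂} → Poset a ℓ₁ ℓ₂ → Set (a ⊔ lsuc ℓ₁ ⊔ ℓ₂)
OrderScattered {ℓ₁ = ℓ₁} A =
  ¬ (∃[ X ] X Respects (Poset._≈_ A) × IsoToℚ (Subposet {x = ℓ₁} A X))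

module _ {c ℓ₁ ℓ₂} (P : Poset c ℓ₁ ℓ₂) where

  open Poset P using (Carrier; _≈_; _≤_; module Eq)
  open ToStrict _≈_ _≤_ using (_<_)

  StrictOrder : Setoid (c ⊔ ℓ₁ ⊔ ℓ₂) ℓ₁
  StrictOrder = On.setoid {B = Σ (Carrier × Carrier) λ (p , q) → p < q}
                          (×-setoid Eq.setoid Eq.setoid) proj₁

  record Suborder (r : Level) : Set (c ⊔ ℓ₁ ⊔ ℓ₂ ⊔ lsuc r) where
    field
      rel        : Rel Carrier r
      respects   : rel Respects₂ _≈_
      included   : rel ⇒ _<_
      transitive : Transitive rel

  open Suborder

  -- Only the order of the lattice of suborders matters for scatteredness.

  SuborderPoset : (r : Level) → Poset (c ⊔ ℓ₁ ⊔ ℓ₂ ⊔ lsuc r) (c ⊔ r) (c ⊔ r)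
  SuborderPoset r = record
    { Carrier = Suborder r
    ; _≈_ = λ R T → rel R ⇔ rel T
    ; _≤_ = λ R T → rel R ⇒ rel T
    ; isPartialOrder = record
      { isPreorder = record
        { isEquivalence = record
          { refl  = id , id
          ; sym   = λ (f , g) → g , f
          ; trans = λ (f , g) (h , k) → (λ z → h (f z)) , (λ z → g (k z))
          }
        ; reflexive = proj₁
        ; trans = λ f g z → g (f z)
        }
      ; antisym = λ f g → f , g
      }
    }

{-# OPTIONS --safe #-}

-- If S(P) is infinite, then greedily choosing pairs, either all with the same
-- source, or all with the same target, or pairwise disjoint, gives infinitely
-- many pairs no two of which compose. Every set of such pairs is vacuously
-- transitive, so O(P) contains a copy of the power set of a countable set,
-- hence a copy of ℚ: send q to the pairs with index at most q. Conversely, the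
-- images of 0 < 1 < 2 < … under an embedding of ℚ are strictly increasing
-- suborders, and choosing a pair in each difference gives infinitely many
-- distinct elements of S(P).

module Submission where

open import Defs
open import Axiom.ExcludedMiddle using (ExcludedMiddle)
open import Data.Fin.Base using (Fin; zero; suc; toℕ)
import Data.Fin.Properties as Fin
open import Data.Integer.Base using (ℤ; +_; -[1+_]; +≤+)
import Data.Integer.Properties as ℤ
open import Data.List.Base using (List; []; _∷_; [_]; _++_; concatMap; deduplicate; length; lookup)
import Data.List.Membership.Setoid as Membership
import Data.List.Membership.Setoid.Properties as ∈ₛ
import Data.List.Membership.Propositional.Properties as ∈ₚ
import Data.List.Relation.Unary.All as All
open import Data.List.Relation.Unary.AllPairs using (_∷_)
open import Data.List.Relation.Unary.Any as Any using (Any; here; there)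
import Data.List.Relation.Unary.Any.Properties as Any
open import Data.List.Relation.Unary.Enumerates.Setoid.Properties
  using (deduplicate⁺; lookup-surjective)
open import Data.List.Relation.Unary.Unique.DecSetoid.Properties using (deduplicate-!)
open import Data.List.Relation.Unary.Unique.Setoid using (Unique)
open import Data.Nat.Base using (ℕ; zero; suc; _+_; _*_; _≤_; _<_)
open import Data.Nat.Properties
open import Data.Product.Base using (∃-syntax; _×_; _,_; proj₁; proj₂)
open import Data.Rational.Base using (ℚ; mkℚ; *≤*) renaming (_≤_ to _≤ℚ_)
open import Data.Rational.Literals using (fromℤ)
import Data.Rational.Properties as ℚ
open import Data.Sum.Base using (inj₁; inj₂; [_,_]′)
open import Function.Base using (_∘_)
open import Function.Bundles using (_⇔_; mk⇔; Bijection)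
open import Function.Definitions using (Injective)
open import Level using (Level; Lift; lift)
open import Relation.Binary.Bundles using (Poset; Setoid; DecSetoid)
open import Relation.Binary.Definitions using (tri<; tri≈; tri>)
open import Relation.Binary.Morphism.Structures using (IsOrderIsomorphism)
open import Relation.Binary.PropositionalEquality.Core
  using (_≡_; refl; sym; trans; cong; subst)
open import Relation.Nullary.Decidable using (True; toWitness; fromWitness; decidable-stable; yes; no)
open import Relation.Nullary.Negation using (¬_; contradiction)
open import Relation.Unary using (Pred; U; _∪_)

private
  variable
    a ℓ q b : Level

-- An injective numbering of the rationals.

pair : ℕ → ℕ → ℕ
pair m n = (m + n) * (m + n) + m

private
  -- With `s = m + n`, the code lies between `s * s` and `s * s + s`, hence below the next square:
  -- different sums give disjoint blocks of codes.
  pair-mono-< : ∀ m n k l → m + n < k + l → pair m n < pair k l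
  pair-mono-< m n k l s<t = begin-strict
    s * s + m        ≤⟨ +-monoʳ-≤ (s * s) (m≤m+n m n) ⟩
    s * s + s        ≡⟨ +-comm (s * s) s ⟩
    suc s * s        <⟨ *-monoʳ-< (suc s) (n<1+n s) ⟩
    suc s * suc s    ≤⟨ *-mono-≤ s<t s<t ⟩
    t * t            ≤⟨ m≤m+n (t * t) k ⟩
    t * t + k        ∎
    where
    open ≤-Reasoning
    s = m + n
    t = k + l

pair-injective : ∀ m n k l → pair m n ≡ pair k l → m ≡ k × n ≡ l
pair-injective m n k l eq with <-cmp (m + n) (k + l)
... | tri< s<t _ _ = contradiction eq (<⇒≢ (pair-mono-< m n k l s<t))
... | tri> _ _ t<s = contradiction (sym eq) (<⇒≢ (pair-mono-< k l m n t<s))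
... | tri≈ _ s≡t _ = m≡k , +-cancelˡ-≡ m n l (trans s≡t (cong (_+ l) (sym m≡k)))
  where
  m≡k : m ≡ k
  m≡k = +-cancelˡ-≡ ((m + n) * (m + n)) m k
          (trans eq (cong (λ s → s * s + k) (sym s≡t)))

codeℤ : ℤ → ℕ
codeℤ (+ n)    = pair 0 n
codeℤ -[1+ n ] = pair 1 n

codeℤ-injective : Injective _≡_ _≡_ codeℤ
codeℤ-injective {+ m}       {+ n}       eq = cong +_ (proj₂ (pair-injective 0 m 0 n eq))
codeℤ-injective {+ m}       { -[1+ n ]} eq = contradiction (proj₁ (pair-injective 0 m 1 n eq)) λ ()
codeℤ-injective { -[1+ m ]} {+ n}       eq = contradiction (proj₁ (pair-injective 1 m 0 n eq)) λ ()
codeℤ-injective { -[1+ m ]} { -[1+ n ]} eq = cong -[1+_] (proj₂ (pair-injective 1 m 1 n eq))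

codeℚ : ℚ → ℕ
codeℚ (mkℚ n d _) = pair (codeℤ n) d

codeℚ-injective : Injective _≡_ _≡_ codeℚ
codeℚ-injective {mkℚ n d _} {mkℚ n′ d′ _} eq =
  let n≡n′ , d≡d′ = pair-injective (codeℤ n) d (codeℤ n′) d′ eq in
  -- The coprimality field is irrelevant, so the two numeric fields settle equality.
  ℚ.mkℚ-cong (codeℤ-injective n≡n′) d≡d′

fromℤ-cancel-≤ : ∀ {m n} → fromℤ (+ m) ≤ℚ fromℤ (+ n) → m ≤ n
fromℤ-cancel-≤ {m} {n} p =
  ℤ.drop‿+≤+ (ℤ.*-cancelʳ-≤-pos (+ m) (+ n) (+ 1) (ℚ.drop-*≤* p))

fromℤ-mono-≤ : ∀ {m n} → m ≤ n → fromℤ (+ m) ≤ℚ fromℤ (+ n)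
fromℤ-mono-≤ m≤n = *≤* (ℤ.*-monoʳ-≤-nonNeg (+ 1) (+≤+ m≤n))

-- Finite predicates and injective sequences in a setoid.

module _ (S : Setoid a ℓ) where
  open Setoid S using (Carrier; _≈_) renaming (sym to ≈-sym; trans to ≈-trans)
  open Membership S using (_∈_)

  -- Finiteness without counting: the list may repeat entries or leave `Q`, so unions are mere
  -- concatenation. Duplicates are removed once, in `Covered⇒Finite`.
  Covered : Pred Carrier q → Set _
  Covered Q = ∃[ xs ] (∀ {x} → Q x → x ∈ xs)

  Covered-∪ : {Q : Pred Carrier q} {R : Pred Carrier b} →
              Covered Q → Covered R → Covered (Q ∪ R)
  Covered-∪ (xs , f) (ys , g) =
    xs ++ ys , [ ∈ₛ.∈-++⁺ˡ S ∘ f , ∈ₛ.∈-++⁺ʳ S xs ∘ g ]′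

  Covered-≈ : ∀ x → Covered (x ≈_)
  Covered-≈ x = [ x ] , λ x≈y → here (≈-sym x≈y)

  Unique⇒lookup-injective : ∀ {xs} → Unique S xs → Injective _≡_ _≈_ (lookup xs)
  Unique⇒lookup-injective (_ ∷ _)  {zero}  {zero}  _  = refl
  Unique⇒lookup-injective (p ∷ _)  {zero}  {suc j} eq =
    contradiction eq (All.lookup p (∈ₚ.∈-lookup j))
  Unique⇒lookup-injective (p ∷ _)  {suc i} {zero}  eq =
    contradiction (≈-sym eq) (All.lookup p (∈ₚ.∈-lookup i))
  Unique⇒lookup-injective (_ ∷ ps) {suc i} {suc j} eq =
    cong suc (Unique⇒lookup-injective ps eq)

  ≉-<⇒injective : (e : ℕ → Carrier) → (∀ {i j} → i < j → ¬ e i ≈ e j) →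
                  Injective _≡_ _≈_ e
  ≉-<⇒injective e e-≉ {i} {j} eq with <-cmp i j
  ... | tri< i<j _ _ = contradiction eq (e-≉ i<j)
  ... | tri≈ _ i≡j _ = i≡j
  ... | tri> _ _ j<i = contradiction (≈-sym eq) (e-≉ j<i)

  -- Pigeonhole: two of the `n + 1` terms `e 0`, ..., `e n` get the same index in `Fin n`, and an
  -- index determines its element up to `≈`.
  Finite⇒¬injective : Finite S → (e : ℕ → Carrier) → ¬ Injective _≡_ _≈_ e
  Finite⇒¬injective (n , bij) e e-inj =
    let i , j , i<j , eq = Fin.pigeonhole (n<1+n n) (index ∘ e ∘ toℕ) in
    <⇒≢ i<j (e-inj (≈-trans (≈-sym (to-index _))
      (subst (λ k → to k ≈ e (toℕ j)) (sym eq) (to-index _))))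
    where
    open Bijection bij using (to; strictlySurjective)

    index : Carrier → Fin n
    index x = proj₁ (strictlySurjective x)

    to-index : ∀ x → to (index x) ≈ x
    to-index x = proj₂ (strictlySurjective x)

module _ (em : ∀ {ℓ} → ExcludedMiddle ℓ) where

  stable : {A : Set a} → ¬ ¬ A → A
  stable = decidable-stable em

  -- Excluded middle makes every type logically equivalent to one at any level.
  Resize : ∀ r → Set a → Set r
  Resize r A = Lift r (True (em {P = A}))

  resize : ∀ {r} {A : Set a} → A → Resize r A
  resize = lift ∘ fromWitness

  unresize : ∀ {r} {A : Set a} → Resize r A → A
  unresize (lift t) = toWitness t

  -- Finiteness and greedy sequences under excluded middle.

  module _ (S : Setoid a ℓ) where
    open Setoid S using (Carrier; _≈_; isEquivalence)

    -- Excluded middle decides `≈`, so the list can be freed of duplicates; its positions then give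
    -- the bijection.
    Covered⇒Finite : Covered S U → Finite S
    Covered⇒Finite (xs , x∈xs) = length ys , record
      { to        = lookup ys
      ; cong      = λ { refl → Setoid.refl S }
      ; bijective = Unique⇒lookup-injective S (deduplicate-! D xs)
                  , lookup-surjective S (deduplicate⁺ D λ _ → x∈xs _)
      }
      where
      D : DecSetoid _ _
      D = record { isDecEquivalence = record { isEquivalence = isEquivalence ; _≟_ = λ _ _ → em } }
      ys = deduplicate (DecSetoid._≟_ D) xs

    module _ {Q : Pred Carrier q} {B : Carrier → Pred Carrier b}
             (Q-infinite : ¬ Covered S Q) (B-covered : ∀ x → Covered S (B x)) where

      private
        Hits : Carrier → Pred (List Carrier) _
        Hits x = Any (λ y → B y x)

        -- `B y` is what choosing `y` forbids later. If the choices in `xs` forbade all of `Q`,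
        -- concatenating the covers of their sets `B y` would cover `Q`.
        fresh : ∀ xs → ∃[ x ] Q x × ¬ Hits x xs
        fresh xs = stable λ ¬fresh → Q-infinite
          ( concatMap (proj₁ ∘ B-covered) xs
          , λ {x} Qx → Any.concatMap⁺ _ (Any.map (λ {y} → proj₂ (B-covered y))
                         (stable λ ¬hit → ¬fresh (x , Qx , ¬hit))))

        -- The recursion carries all earlier choices, since each new one must avoid them all;
        -- `history j` holds exactly the terms with index below `j`.
        history : ℕ → List Carrier
        history zero    = []
        history (suc n) = proj₁ (fresh (history n)) ∷ history n

        e : ℕ → Carrier
        e n = proj₁ (fresh (history n))

        hits : ∀ {i} j {x} → i < j → B (e i) x → Hits x (history j)
        hits (suc j) i<1+j Bx with m<1+n⇒m<n∨m≡n i<1+j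
        ... | inj₁ i<j  = there (hits j i<j Bx)
        ... | inj₂ refl = here Bx

      avoidingSequence : ∃[ e ] (∀ i → Q (e i)) × (∀ {i j} → i < j → ¬ B (e i) (e j))
      avoidingSequence = e , (λ i → proj₁ (proj₂ (fresh (history i))))
        , λ {i} {j} i<j Bx → proj₂ (proj₂ (fresh (history j))) (hits j i<j Bx)

  -- Infinite families of pairs that never compose.

  module _ {c ℓ₁ ℓ₂} (P : Poset c ℓ₁ ℓ₂) where
    open Poset P using (_≈_; module Eq) renaming (Carrier to V)

    private
      E = StrictOrder P

    open Setoid E using () renaming (Carrier to Edge; _≈_ to _≈ₑ_)

    src tgt : Edge → V
    src ((p , _) , _) = p
    tgt ((_ , q) , _) = q

    src≉tgt : ∀ s → ¬ src s ≈ tgt s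
    src≉tgt (_ , _ , p≉q) = p≉q

    -- The index set varies because pairs are chosen along `ℕ` and later reindexed by `ℚ`.
    NonComposable : {I : Set} → (I → Edge) → Set ℓ₁
    NonComposable e = ∀ i j → ¬ tgt (e i) ≈ src (e j)

    From To : V → Pred Edge ℓ₁
    From v s = v ≈ src s
    To   v s = v ≈ tgt s

    -- Among pairs with a common source, or a common target, a composite would force one of them to
    -- have equal ends. If neither kind of family is ever infinite, each vertex starts and ends
    -- finitely many pairs, so a greedy choice can forbid all pairs meeting it badly.
    infinite⇒nonComposable : ¬ Covered E U →
      ∃[ e ] Injective _≡_ _≈ₑ_ e × NonComposable {ℕ} e
    infinite⇒nonComposable inf with em {_} {∃[ v ] ¬ Covered E (From v)}
    -- The greedy choice only has to make the terms distinct here.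
    ... | yes (v , v-inf) with avoidingSequence E v-inf (Covered-≈ E)
    ...   | e , v≈src , e-≉ = e , ≉-<⇒injective E e e-≉
          , λ i j t≈s → src≉tgt (e i) (Eq.trans (Eq.sym (v≈src i)) (Eq.trans (v≈src j) (Eq.sym t≈s)))
    infinite⇒nonComposable inf | no ¬from with em {_} {∃[ v ] ¬ Covered E (To v)}
    ... | yes (v , v-inf) with avoidingSequence E v-inf (Covered-≈ E)
    ...   | e , v≈tgt , e-≉ = e , ≉-<⇒injective E e e-≉
          , λ i j t≈s → src≉tgt (e j) (Eq.trans (Eq.sym t≈s) (Eq.trans (Eq.sym (v≈tgt i)) (v≈tgt j)))
    infinite⇒nonComposable inf | no ¬from | no ¬to =
      e , ≉-<⇒injective E e (λ i<j eq → avoids i<j (inj₁ (proj₁ eq))) , nonComposable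
      where
      from-covered : ∀ v → Covered E (From v)
      from-covered v = stable λ ¬c → ¬from (v , ¬c)

      to-covered : ∀ v → Covered E (To v)
      to-covered v = stable λ ¬c → ¬to (v , ¬c)

      -- The first set keeps later pairs distinct from `s`; the second forbids starting where `s`
      -- ends, the third ending where `s` starts. Shared targets stay allowed, as they create no
      -- composite.
      sequence = avoidingSequence E
        {B = λ s → From (src s) ∪ From (tgt s) ∪ To (src s)} inf
        λ s → Covered-∪ E (from-covered (src s))
                (Covered-∪ E (from-covered (tgt s)) (to-covered (src s)))

      e = proj₁ sequence
      avoids = proj₂ (proj₂ sequence)

      nonComposable : NonComposable e
      nonComposable i j t≈s with <-cmp i j
      ... | tri< i<j _ _  = avoids i<j (inj₂ (inj₁ t≈s))
      ... | tri≈ _ refl _ = src≉tgt (e i) (Eq.sym t≈s)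
      ... | tri> _ _ j<i  = avoids j<i (inj₂ (inj₂ (Eq.sym t≈s)))

    -- A copy of `ℚ` among the suborders.

    module _ (r : Level) (e : ℚ → Edge) (e-inj : Injective _≡_ _≈ₑ_ e) (e-nc : NonComposable e) where

      open Poset (SuborderPoset P r) using () renaming (_≈_ to _≋_; module Eq to ≋)

      private
        Below : ℚ → V → V → Set ℓ₁
        Below q x y = ∃[ p ] p ≤ℚ q × src (e p) ≈ x × tgt (e p) ≈ y

        below : ℚ → Suborder P r
        below q = record
          -- `Below` lives at level `ℓ₁`, while the suborders considered take values at level `r`.
          { rel        = λ x y → Resize r (Below q x y)
          ; respects   = (λ y≈z R → let p , p≤q , s , t = unresize R in
                           resize (p , p≤q , s , Eq.trans t y≈z))
                       , (λ x≈z R → let p , p≤q , s , t = unresize R in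
                           resize (p , p≤q , Eq.trans s x≈z , t))
          ; included   = λ R → let p , _ , s , t = unresize R
                                   (_ , s≤t , s≉t) = e p in
                           Poset.≤-respˡ-≈ P s (Poset.≤-respʳ-≈ P t s≤t)
                           , λ x≈y → s≉t (Eq.trans s (Eq.trans x≈y (Eq.sym t)))
          -- Vacuous: the target of `e p` would be the source of `e p′`.
          ; transitive = λ R R′ → let p , _ , _ , t = unresize R
                                      p′ , _ , s , _ = unresize R′ in
                           contradiction (Eq.trans t (Eq.sym s)) (e-nc p p′)
          }

        below-mono : ∀ {p q} → p ≤ℚ q → Poset._≤_ (SuborderPoset P r) (below p) (below q)
        below-mono p≤q R = let o , o≤p , st = unresize R in
          resize (o , ℚ.≤-trans o≤p p≤q , st)

        -- The pair `e p` itself lies in `below p`, hence equals some `e o` with `o ≤ℚ q`, and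
        -- injectivity gives `o ≡ p`.
        below-cancel : ∀ {p q} → Poset._≤_ (SuborderPoset P r) (below p) (below q) → p ≤ℚ q
        below-cancel {p} {q} sub
          with o , o≤q , st ← unresize (sub (resize (p , ℚ.≤-refl , Eq.refl , Eq.refl)))
          = subst (_≤ℚ q) (e-inj st) o≤q

      nonComposable⇒¬OrderScattered : ¬ OrderScattered (SuborderPoset P r)
      nonComposable⇒¬OrderScattered scattered = scattered
        -- The image of `below` is closed under `≋`, so it respects equality and sits at the level
        -- of `≋`, as `OrderScattered` demands.
        ( (λ R → ∃[ q ] below q ≋ R)
        , (λ { {R} {T} R≋T (q , q≋R) → q , ≋.trans {below q} {R} {T} q≋R R≋T })
        , (λ q → below q , q , ≋.refl {below q})
        , record
          { isOrderMonomorphism = record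
            { isOrderHomomorphism = record
              { cong = λ { {q} refl → ≋.refl {below q} }
              ; mono = below-mono
              }
            ; injective = λ (f , g) → ℚ.≤-antisym (below-cancel f) (below-cancel g)
            ; cancel    = below-cancel
            }
          ; surjective = λ { (_ , q , q≋R) → q , λ { refl → q≋R } }
          }
        )

    -- No copy of `ℚ` when the strict order is finite.

    Finite⇒OrderScattered : ∀ r → Finite E → OrderScattered (SuborderPoset P r)
    Finite⇒OrderScattered r fin (X , _ , f , iso) =
      Finite⇒¬injective E fin e (≉-<⇒injective E e e-≉)
      where
      open IsOrderIsomorphism iso using (mono; cancel)

      R : ℕ → V → V → Set r
      R n = Suborder.rel (proj₁ (f (fromℤ (+ n))))

      -- An inclusion of `R (suc n)` in `R n` would be reflected to `suc n ≤ n`. Membership in a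
      -- suborder makes the missing pair strict, hence an `Edge`.
      gap : ∀ n → ∃[ s ] R (suc n) (src s) (tgt s) × ¬ R n (src s) (tgt s)
      gap n = stable λ ¬gap → <⇒≱ (n<1+n n) (fromℤ-cancel-≤ (cancel λ {x} {y} Rxy →
        stable λ ¬Rxy → ¬gap ((_ , Suborder.included (proj₁ (f _)) Rxy) , Rxy , ¬Rxy)))

      e : ℕ → Edge
      e n = proj₁ (gap n)

      -- `e i` lies in `R (suc i)`, which `R j` contains because `suc i ≤ j`, whereas `e j` was
      -- chosen outside `R j`.
      e-≉ : ∀ {i j} → i < j → ¬ e i ≈ₑ e j
      e-≉ {i} {j} i<j (s , t) = proj₂ (proj₂ (gap j))
        (proj₁ respects t (proj₂ respects s (mono (fromℤ-mono-≤ i<j) (proj₁ (proj₂ (gap i))))))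
        where open Suborder (proj₁ (f (fromℤ (+ j)))) using (respects)

theorem6p2 : (∀ {ℓ} → ExcludedMiddle ℓ) →
    ∀ {c ℓ₁ ℓ₂} r (P : Poset c ℓ₁ ℓ₂) →
    OrderScattered (SuborderPoset P r) ⇔ Finite (StrictOrder P)
theorem6p2 em r P = mk⇔
  (λ scattered → Covered⇒Finite em (StrictOrder P) (decidable-stable em λ infinite →
    let e , e-inj , e-nc = infinite⇒nonComposable em P infinite in
    -- Injectivity and noncomposability ignore the order of the indices, so they survive reindexing
    -- along any injection of `ℚ` into `ℕ`.
    nonComposable⇒¬OrderScattered em P r (e ∘ codeℚ) (codeℚ-injective ∘ e-inj)
      (λ p q → e-nc (codeℚ p) (codeℚ q)) scattered))
  (Finite⇒OrderScattered em P r)
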